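{- Let $n>1$ be an integer and $p=c/(2n)$ with $c\in\{1,\dots,2n-1\}$. Then there are exactly $2^{\aleph_0}$ pairwise non-isomorphic $p$-biased functions on $\mathbb{Z}^n$.
   Context: $\mathbb{Z}^n$ is the graph with edges $\{x,x+e_i\}$, $x\in\mathbb{Z}^n$, $i\in\{1,\dots,n\}$; $\Gamma(x)=\{x\pm e_i\}$. A function $f:\mathbb{Z}^n\to\{0,1\}$ (identified with its support $X$) is $p$-biased if $|\Gamma(x)\cap X|=2pn$ for every $x\in\mathbb{Z}^n$. Two such functions $f,g$ are isomorphic if there is a graph automorphism $\phi$ of $\mathbb{Z}^n$ with $f=g\circ\phi$ (equivalently $\phi$ maps the support of $f$ onto the support of $g$). -}

module Defs where

open import Data.Nat as ℕ using (ℕ)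
open import Data.Integer as ℤ using (ℤ)
open import Data.Fin using (Fin)
open import Data.Vec using (Vec; updateAt)
open import Data.List using (List; map)
open import Data.Nat.ListAction using (sum)
open import Data.Fin.Base using ()
open import Data.List.Base using ()
open import Data.Bool using (Bool; true; false)
open import Data.Product using (Σ; ∃; _×_)
open import Data.Sum using (_⊎_)
open import Relation.Binary.PropositionalEquality using (_≡_)
import Data.List as L

Point : ℕ → Set
Point n = Vec ℤ n

_+e_ : ∀ {n} → Point n → Fin n → Point n
x +e i = updateAt x i ℤ.suc

_-e_ : ∀ {n} → Point n → Fin n → Point n
x -e i = updateAt x i ℤ.pred

Adj : ∀ {n} → Point n → Point n → Set
Adj {n} x y = Σ (Fin n) λ i → (y ≡ x +e i) ⊎ (x ≡ y +e i)

toℕ : Bool → ℕ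
toℕ true = 1
toℕ false = 0

nbrCount : ∀ {n} → (Point n → Bool) → Point n → ℕ
nbrCount {n} f x = sum (map (λ i → toℕ (f (x +e i)) ℕ.+ toℕ (f (x -e i))) (L.allFin n))

-- f is p-biased with p = c / (2n), i.e. |Γ(x) ∩ X| = 2pn = c for all x
Biased : (n c : ℕ) → (Point n → Bool) → Set
Biased n c f = ∀ (x : Point n) → nbrCount f x ≡ c

record Automorphism (n : ℕ) : Set where
  field
    φ       : Point n → Point n
    φ⁻¹     : Point n → Point n
    invˡ    : ∀ x → φ⁻¹ (φ x) ≡ x
    invʳ    : ∀ y → φ (φ⁻¹ y) ≡ y
    pres    : ∀ x y → Adj x y → Adj (φ x) (φ y)
    refl'   : ∀ x y → Adj (φ x) (φ y) → Adj x y

Iso : ∀ {n} → (Point n → Bool) → (Point n → Bool) → Set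
Iso {n} f g = Σ (Automorphism n) λ A → ∀ x → f x ≡ g (Automorphism.φ A x)

{-# OPTIONS --safe #-}
module Submission where

-- Put u = Σ xᵢ and v = Σ i xᵢ. The neighbours of x lie on the two heights u ± 1, and on each of
-- them their values of v form n consecutive integers. So a set that on each height u is n-periodic
-- in v, with w(u) residues per period, is c-biased as soon as w(u - 1) + w(u + 1) = c; a width
-- pattern a, a, b, b of period 4 with a + b = c does this, and every height may be translated in v
-- at will. Translating blocks of 4n heights by 0 or 1 writes an arbitrary signal ℤ → {0,1} into
-- the set, and the signal can be read along any coordinate line in steps of 4n. An automorphism maps
-- coordinate lines to coordinate lines, because two neighbours of a point are antipodal exactly when
-- they have no other common neighbour. Hence an isomorphism relates the two signals by z ↦ q ± z,
-- followed by some map {0,1} → {0,1}, and suitable signals are recovered from this.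

open import Defs
open import Data.Nat using (ℕ; _<_; _≤_; _*_)
open import Data.Bool using (Bool)
open import Data.Product using (Σ; _×_)
open import Relation.Binary.PropositionalEquality using (_≡_)

open import Data.Bool using (true; false)
open import Data.Fin using (Fin; zero; suc) renaming (toℕ to index)
import Data.Fin.Properties as Fin
open import Data.Integer as ℤ using (ℤ; +_; -[1+_]; 0ℤ; 1ℤ; -1ℤ; ∣_∣; _%ℕ_; _/ℕ_)
open import Data.Integer.DivMod using (a≡a%ℕn+[a/ℕn]*n; n%ℕd<d)
import Data.Integer.Properties as ℤ
open import Algebra.Properties.AbelianGroup ℤ.+-0-abelianGroup using (∙-cancelʳ)
open import Data.Integer.Tactic.RingSolver using (solve-∀)
open import Data.List using (tabulate)
open import Data.List.Properties using (map-tabulate)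
open import Data.Nat as ℕ using (zero; suc; _+_; NonZero; z≤n; s≤s; _<?_)
open import Data.Nat.Binary using (ℕᵇ; 2[1+_]; 1+[2_]) renaming (toℕ to toNat; fromℕ to fromNat)
import Data.Nat.Binary as ℕᵇ
import Data.Nat.Binary.Properties as ℕᵇ
open import Data.Nat.DivMod using (m<n⇒m%n≡m)
open import Data.Nat.ListAction using (sum)
import Data.Nat.Properties as ℕ
import Data.Nat.Tactic.RingSolver as ℕSolver
open import Data.Product using (_,_; proj₁; proj₂)
open import Data.Sign using (Sign; opposite) renaming (+ to ⊕; - to ⊖; _*_ to _·_)
import Data.Sign.Properties as Sign
open import Data.Sum using (inj₁; inj₂)
open import Data.Vec using ([]; _∷_; lookup; replicate; updateAt)
import Data.Vec.Properties as Vec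
open import Function using (_∘_)
open import Relation.Binary.Definitions using (tri<; tri≈; tri>)
open import Relation.Binary.PropositionalEquality
  using (_≢_; refl; sym; trans; cong; cong₂; subst; module ≡-Reasoning)
open import Relation.Nullary using (Dec; does; yes; no; contradiction)
open import Relation.Nullary.Decidable using (dec-true; dec-false)

-- Lattice moves

unit : Sign → ℤ
unit ⊕ = 1ℤ
unit ⊖ = -1ℤ

move : ∀ {n} → Sign → Fin n → Point n → Point n
move s i x = updateAt x i (λ a → unit s ℤ.+ a)

move-comm : ∀ {n} s i t j (x : Point n) →
  move s i (move t j x) ≡ move t j (move s i x)
move-comm s zero    t zero    (a ∷ x) = cong (_∷ x) (swap (unit s) (unit t) a)
  where
  swap : ∀ p q r → p ℤ.+ (q ℤ.+ r) ≡ q ℤ.+ (p ℤ.+ r)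
  swap = solve-∀
move-comm s zero    t (suc j) (a ∷ x) = refl
move-comm s (suc i) t zero    (a ∷ x) = refl
move-comm s (suc i) t (suc j) (a ∷ x) = cong (a ∷_) (move-comm s i t j x)

unit-cancel : ∀ s a → unit s ℤ.+ (unit (opposite s) ℤ.+ a) ≡ a
unit-cancel ⊕ = ℤ.suc-pred
unit-cancel ⊖ = ℤ.pred-suc

move-cancel : ∀ {n} s i (x : Point n) → move s i (move (opposite s) i x) ≡ x
move-cancel s i x =
  trans (Vec.updateAt-updateAt i x)
        (Vec.updateAt-id-local i x (unit-cancel s (lookup x i)))

move-adj : ∀ {n} s i (x : Point n) → Adj x (move s i x)
move-adj ⊕ i x = i , inj₁ refl
move-adj ⊖ i x = i , inj₂ (sym (move-cancel ⊕ i x))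

adj-move : ∀ {n} {x y : Point n} → Adj x y → Σ Sign λ s → Σ (Fin n) λ i → y ≡ move s i x
adj-move (i , inj₁ y≡) = ⊕ , i , y≡
adj-move {y = y} (i , inj₂ x≡) =
  ⊖ , i , trans (sym (move-cancel ⊖ i y)) (cong (move ⊖ i) (sym x≡))

unit≤1 : ∀ s → unit s ℤ.≤ 1ℤ
unit≤1 ⊕ = ℤ.≤-refl
unit≤1 ⊖ = ℤ.-≤+

lookup-move-≤ : ∀ {n} s i j (x : Point n) → lookup (move s i x) j ℤ.≤ 1ℤ ℤ.+ lookup x j
lookup-move-≤ s i j x with j Fin.≟ i
... | yes refl = ℤ.≤-trans (ℤ.≤-reflexive (Vec.lookup∘updateAt i x))
                           (ℤ.+-monoˡ-≤ (lookup x i) (unit≤1 s))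
... | no j≢i   = ℤ.≤-trans (ℤ.≤-reflexive (Vec.lookup∘updateAt′ j i j≢i x))
                           (ℤ.i≤suc[i] (lookup x j))

-- In coordinate i, a step from w + eᵢ other than the one back to w stays above wᵢ,
-- whereas a step from w - eᵢ reaches at most wᵢ.
common-neighbour⁺ : ∀ {n} s j t k i (w : Point n) →
  move s j (move ⊕ i w) ≡ move t k (move ⊖ i w) → move s j (move ⊕ i w) ≡ w
common-neighbour⁺ s j t k i w eq = back-or-high s refl (i Fin.≟ j)
  where
  open ℤ.≤-Reasoning

  low : lookup (move s j (move ⊕ i w)) i ℤ.≤ lookup w i
  low = begin
    lookup (move s j (move ⊕ i w)) i   ≡⟨ cong (λ z → lookup z i) eq ⟩
    lookup (move t k (move ⊖ i w)) i   ≤⟨ lookup-move-≤ t k i (move ⊖ i w) ⟩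
    1ℤ ℤ.+ lookup (move ⊖ i w) i       ≡⟨ cong (λ a → 1ℤ ℤ.+ a) (Vec.lookup∘updateAt i w) ⟩
    1ℤ ℤ.+ (-1ℤ ℤ.+ lookup w i)        ≡⟨ unit-cancel ⊕ (lookup w i) ⟩
    lookup w i                         ∎

  not-high : lookup w i ℤ.< lookup (move s j (move ⊕ i w)) i →
             move s j (move ⊕ i w) ≡ w
  not-high high = contradiction (ℤ.<-≤-trans high low) (ℤ.<-irrefl refl)

  lookup-up : lookup (move ⊕ i w) i ≡ 1ℤ ℤ.+ lookup w i
  lookup-up = Vec.lookup∘updateAt i w

  back-or-high : ∀ r → r ≡ s → Dec (i ≡ j) → move s j (move ⊕ i w) ≡ w
  back-or-high r r≡s (no i≢j) = not-high (begin-strict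
    lookup w i                         <⟨ ℤ.suc[i]≤j⇒i<j ℤ.≤-refl ⟩
    1ℤ ℤ.+ lookup w i                  ≡⟨ lookup-up ⟨
    lookup (move ⊕ i w) i              ≡⟨ Vec.lookup∘updateAt′ i j i≢j (move ⊕ i w) ⟨
    lookup (move s j (move ⊕ i w)) i   ∎)
  back-or-high ⊖ refl (yes refl) = move-cancel ⊖ i w
  back-or-high ⊕ refl (yes refl) = not-high (begin-strict
    lookup w i                         <⟨ ℤ.suc[i]≤j⇒i<j ℤ.≤-refl ⟩
    1ℤ ℤ.+ lookup w i                  ≤⟨ ℤ.i≤suc[i] _ ⟩
    1ℤ ℤ.+ (1ℤ ℤ.+ lookup w i)         ≡⟨ cong (λ a → 1ℤ ℤ.+ a) lookup-up ⟨
    1ℤ ℤ.+ lookup (move ⊕ i w) i       ≡⟨ Vec.lookup∘updateAt i (move ⊕ i w) ⟨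
    lookup (move ⊕ i (move ⊕ i w)) i   ∎)

-- For `⊖` the two neighbours exchange roles, so both signs reduce to `common-neighbour⁺`. This is
-- what lets adjacency alone recognise antipodal neighbours.
common-neighbour : ∀ {n} r i {w z : Point n} →
  Adj (move r i w) z → Adj (move (opposite r) i w) z → z ≡ w
common-neighbour r i {w} p q with adj-move p | adj-move q
common-neighbour ⊕ i {w} _ _ | s , j , z≡ | t , k , z≡′ =
  trans z≡ (common-neighbour⁺ s j t k i w (trans (sym z≡) z≡′))
common-neighbour ⊖ i {w} _ _ | s , j , z≡ | t , k , z≡′ =
  trans z≡′ (common-neighbour⁺ t k s j i w (trans (sym z≡′) z≡))

-- Images of coordinate lines under automorphisms

walk : ∀ {n} → Sign → Fin n → ℕ → Point n → Point n
walk s i zero    x = x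
walk s i (suc m) x = move s i (walk s i m x)

module _ {n} (A : Automorphism n) where
  open Automorphism A

  -- Unless the images of the two antipodal neighbours of w are antipodal, they have a common
  -- neighbour besides φ w; its preimage would be a common neighbour besides w.
  antipodal : ∀ s i t k (w : Point n) →
    φ (move (opposite s) i w) ≡ move (opposite t) k (φ w) →
    φ (move s i w) ≡ move t k (φ w)
  antipodal s i t k w back = begin
    φ (move s i w)                                    ≡⟨ ahead ⟩
    move d l (φ w)                                    ≡⟨ move-cancel t k _ ⟨
    move t k (move (opposite t) k (move d l (φ w)))   ≡⟨ cong (move t k) (move-comm (opposite t) k d l (φ w)) ⟩
    move t k y                                        ≡⟨ cong (move t k) y≡φw ⟩
    move t k (φ w)                                    ∎
    where
    open ≡-Reasoning

    image = adj-move (pres w (move s i w) (move-adj s i w))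
    d = proj₁ image
    l = proj₁ (proj₂ image)

    ahead : φ (move s i w) ≡ move d l (φ w)
    ahead = proj₂ (proj₂ image)

    -- The fourth corner of the parallelogram spanned at `φ w` by the images of the two neighbours.
    -- It is adjacent to both images even if they coincide, so no case distinction arises.
    y = move d l (move (opposite t) k (φ w))

    adj-ahead : Adj (φ (move s i w)) y
    adj-ahead = subst (Adj _) (trans (cong (move (opposite t) k) ahead)
                                     (move-comm (opposite t) k d l (φ w)))
                      (move-adj (opposite t) k (φ (move s i w)))

    adj-back : Adj (φ (move (opposite s) i w)) y
    adj-back = subst (Adj _) (cong (move d l) back) (move-adj d l _)

    pull : ∀ {v} → Adj (φ v) y → Adj v (φ⁻¹ y)
    pull {v} p = refl' v (φ⁻¹ y) (subst (Adj (φ v)) (sym (invʳ y)) p)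

    y≡φw : y ≡ φ w
    y≡φw = trans (sym (invʳ y)) (cong φ (common-neighbour s i (pull adj-ahead) (pull adj-back)))

  -- This is `antipodal` at the middle point `move s i v`: the image of its predecessor `v` lies one
  -- step back, so the image of its successor lies one step ahead.
  straight-step : ∀ s i t k v p →
    φ v ≡ p → φ (move s i v) ≡ move t k p →
    φ (move s i (move s i v)) ≡ move t k (move t k p)
  straight-step s i t k v p φv≡ φsv≡ = begin
    φ (move s i (move s i v))   ≡⟨ antipodal s i t k (move s i v) back ⟩
    move t k (φ (move s i v))   ≡⟨ cong (move t k) φsv≡ ⟩
    move t k (move t k p)       ∎
    where
    open ≡-Reasoning

    retreat : ∀ r j (v : Point n) → move (opposite r) j (move r j v) ≡ v
    retreat ⊕ = move-cancel ⊖
    retreat ⊖ = move-cancel ⊕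

    back : φ (move (opposite s) i (move s i v)) ≡ move (opposite t) k (φ (move s i v))
    back = begin
      φ (move (opposite s) i (move s i v))    ≡⟨ cong φ (retreat s i v) ⟩
      φ v                                     ≡⟨ φv≡ ⟩
      p                                       ≡⟨ retreat t k p ⟨
      move (opposite t) k (move t k p)        ≡⟨ cong (move (opposite t) k) φsv≡ ⟨
      move (opposite t) k (φ (move s i v))    ∎

  -- A direction is carried on only by two consecutive points, hence the induction with two base
  -- cases.
  ray-image : ∀ s i t k x → φ (move s i x) ≡ move t k (φ x) →
    ∀ m → φ (walk s i m x) ≡ walk t k m (φ x)
  ray-image s i t k x first zero          = refl
  ray-image s i t k x first (suc zero)    = first
  ray-image s i t k x first (suc (suc m)) =
    straight-step s i t k (walk s i m x) (walk t k m (φ x))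
      (ray-image s i t k x first m) (ray-image s i t k x first (suc m))

  -- The first step in direction `⊕` fixes `s` and `k`. By `antipodal` at `x` the first step in
  -- direction `⊖` then goes the opposite way, so both rays land on one line.
  line-image : ∀ i x → Σ Sign λ s → Σ (Fin n) λ k →
    ∀ r m → φ (walk r i m x) ≡ walk (s · r) k m (φ x)
  line-image i x with adj-move (pres x (move ⊕ i x) (move-adj ⊕ i x))
  ... | s , k , φ≡ = s , k , image
    where
    image : ∀ r m → φ (walk r i m x) ≡ walk (s · r) k m (φ x)
    image ⊕ rewrite Sign.*-identityʳ s = ray-image ⊕ i s k x φ≡
    image ⊖ rewrite Sign.*-comm s ⊖ = ray-image ⊖ i (opposite s) k x
      (antipodal ⊖ i (opposite s) k x (trans φ≡ (cong (λ t → move t k (φ x)) (sym (Sign.opposite-involutive s)))))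

-- Linear functionals

height : ∀ {n} → Point n → ℤ
height []      = 0ℤ
height (a ∷ x) = a ℤ.+ height x

-- Σ i xᵢ with indices from 0: prepending a raises every index of x by one, which adds height x.
moment : ∀ {n} → Point n → ℤ
moment []      = 0ℤ
moment (a ∷ x) = height x ℤ.+ moment x

height-move : ∀ {n} s i (x : Point n) → height (move s i x) ≡ unit s ℤ.+ height x
height-move s zero    (a ∷ x) = ℤ.+-assoc (unit s) a (height x)
height-move s (suc i) (a ∷ x) rewrite height-move s i x = lemma (unit s) a (height x)
  where
  lemma : ∀ p q r → q ℤ.+ (p ℤ.+ r) ≡ p ℤ.+ (q ℤ.+ r)
  lemma = solve-∀

moment-move : ∀ {n} s i (x : Point n) →
  moment (move s i x) ≡ unit s ℤ.* + index i ℤ.+ moment x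
moment-move s zero    (a ∷ x) = lemma (unit s) (height x ℤ.+ moment x)
  where
  lemma : ∀ p q → q ≡ p ℤ.* 0ℤ ℤ.+ q
  lemma = solve-∀
moment-move s (suc i) (a ∷ x) rewrite height-move s i x | moment-move s i x =
  lemma (unit s) (+ index i) (height x) (moment x)
  where
  lemma : ∀ p k q r → (p ℤ.+ q) ℤ.+ (p ℤ.* k ℤ.+ r) ≡ p ℤ.* (1ℤ ℤ.+ k) ℤ.+ (q ℤ.+ r)
  lemma = solve-∀

module _ {n} (s : Sign) (i : Fin n) (x : Point n) where

  height-walk : ∀ m → height (walk s i m x) ≡ height x ℤ.+ unit s ℤ.* + m
  height-walk zero    = lemma (unit s) (height x)
    where
    lemma : ∀ p q → q ≡ q ℤ.+ p ℤ.* 0ℤ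
    lemma = solve-∀
  height-walk (suc m) rewrite height-move s i (walk s i m x) | height-walk m =
    lemma (unit s) (height x) (+ m)
    where
    lemma : ∀ p q r → p ℤ.+ (q ℤ.+ p ℤ.* r) ≡ q ℤ.+ p ℤ.* (1ℤ ℤ.+ r)
    lemma = solve-∀

  moment-walk : ∀ m → moment (walk s i m x) ≡ moment x ℤ.+ (unit s ℤ.* + m) ℤ.* + index i
  moment-walk zero    = lemma (unit s) (+ index i) (moment x)
    where
    lemma : ∀ p k q → q ≡ q ℤ.+ (p ℤ.* 0ℤ) ℤ.* k
    lemma = solve-∀
  moment-walk (suc m) rewrite moment-move s i (walk s i m x) | moment-walk m =
    lemma (unit s) (moment x) (+ m) (+ index i)
    where
    lemma : ∀ p q r k →
      p ℤ.* k ℤ.+ (q ℤ.+ (p ℤ.* r) ℤ.* k) ≡ q ℤ.+ (p ℤ.* (1ℤ ℤ.+ r)) ℤ.* k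
    lemma = solve-∀

-- Euclidean division

module _ {d : ℕ} where

  -- The difference of the quotients times `d` is a difference of two remainders, so its absolute
  -- value is below `d`, which only the multiple 0 satisfies.
  quotient-unique : ∀ {r r′} q q′ → r < d → r′ < d →
    + r ℤ.+ q ℤ.* + d ≡ + r′ ℤ.+ q′ ℤ.* + d → q ≡ q′
  quotient-unique {r} {r′} q q′ r<d r′<d eq =
    ℤ.i-j≡0⇒i≡j q q′ (ℤ.∣i∣≡0⇒i≡0 (vanishes ∣ q ℤ.- q′ ∣ multiple<d))
    where
    rearrange : ∀ a b c e f → a ℤ.+ b ℤ.* f ≡ c ℤ.+ e ℤ.* f → (b ℤ.- e) ℤ.* f ≡ c ℤ.- a
    rearrange a b c e f h = begin
      (b ℤ.- e) ℤ.* f                           ≡⟨ expand a b e f ⟩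
      (a ℤ.+ b ℤ.* f) ℤ.- (a ℤ.+ e ℤ.* f)       ≡⟨ cong (ℤ._- (a ℤ.+ e ℤ.* f)) h ⟩
      (c ℤ.+ e ℤ.* f) ℤ.- (a ℤ.+ e ℤ.* f)       ≡⟨ collapse a c e f ⟩
      c ℤ.- a                                   ∎
      where
      open ≡-Reasoning
      expand : ∀ a b e f → (b ℤ.- e) ℤ.* f ≡ (a ℤ.+ b ℤ.* f) ℤ.- (a ℤ.+ e ℤ.* f)
      expand = solve-∀
      collapse : ∀ a c e f → (c ℤ.+ e ℤ.* f) ℤ.- (a ℤ.+ e ℤ.* f) ≡ c ℤ.- a
      collapse = solve-∀

    multiple<d : ∣ q ℤ.- q′ ∣ * d < d
    multiple<d = begin-strict
      ∣ q ℤ.- q′ ∣ * d         ≡⟨ ℤ.abs-* (q ℤ.- q′) (+ d) ⟨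
      ∣ (q ℤ.- q′) ℤ.* + d ∣   ≡⟨ cong ∣_∣ (rearrange (+ r) q (+ r′) q′ (+ d) eq) ⟩
      ∣ + r′ ℤ.- + r ∣         ≡⟨ cong ∣_∣ (ℤ.m-n≡m⊖n r′ r) ⟩
      ∣ r′ ℤ.⊖ r ∣             ≤⟨ ℤ.∣m⊝n∣≤m⊔n r′ r ⟩
      r′ ℕ.⊔ r                 <⟨ ℕ.⊔-lub r′<d r<d ⟩
      d                        ∎
      where open ℕ.≤-Reasoning

    vanishes : ∀ k → k * d < d → k ≡ 0
    vanishes zero    _    = refl
    vanishes (suc k) kd<d = contradiction kd<d (ℕ.m+n≮m d (k * d))

  remainder-unique : ∀ {r r′} q q′ → r < d → r′ < d →
    + r ℤ.+ q ℤ.* + d ≡ + r′ ℤ.+ q′ ℤ.* + d → r ≡ r′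
  remainder-unique {r} {r′} q q′ r<d r′<d eq with refl ← quotient-unique q q′ r<d r′<d eq =
    ℤ.+-injective (∙-cancelʳ (q ℤ.* + d) (+ r) (+ r′) eq)

module _ (d : ℕ) .{{_ : NonZero d}} (a q : ℤ) where

  private
    b = a ℤ.+ q ℤ.* + d

    shifted : + (b %ℕ d) ℤ.+ (b /ℕ d) ℤ.* + d ≡ + (a %ℕ d) ℤ.+ (a /ℕ d ℤ.+ q) ℤ.* + d
    shifted = begin
      + (b %ℕ d) ℤ.+ (b /ℕ d) ℤ.* + d                    ≡⟨ a≡a%ℕn+[a/ℕn]*n b d ⟨
      a ℤ.+ q ℤ.* + d                                    ≡⟨ cong (ℤ._+ q ℤ.* + d) (a≡a%ℕn+[a/ℕn]*n a d) ⟩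
      + (a %ℕ d) ℤ.+ (a /ℕ d) ℤ.* + d ℤ.+ q ℤ.* + d      ≡⟨ regroup (+ (a %ℕ d)) (a /ℕ d) q (+ d) ⟩
      + (a %ℕ d) ℤ.+ (a /ℕ d ℤ.+ q) ℤ.* + d              ∎
      where
      open ≡-Reasoning
      regroup : ∀ r s t e → r ℤ.+ s ℤ.* e ℤ.+ t ℤ.* e ≡ r ℤ.+ (s ℤ.+ t) ℤ.* e
      regroup = solve-∀

  [a+q*d]%d≡a%d : (a ℤ.+ q ℤ.* + d) %ℕ d ≡ a %ℕ d
  [a+q*d]%d≡a%d = remainder-unique (b /ℕ d) (a /ℕ d ℤ.+ q) (n%ℕd<d b d) (n%ℕd<d a d) shifted

  [a+q*d]/d≡a/d+q : (a ℤ.+ q ℤ.* + d) /ℕ d ≡ a /ℕ d ℤ.+ q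
  [a+q*d]/d≡a/d+q = quotient-unique (b /ℕ d) (a /ℕ d ℤ.+ q) (n%ℕd<d b d) (n%ℕd<d a d) shifted

-- Sums over windows of consecutive integers

window : (ℤ → ℕ) → Sign → ℕ → ℤ → ℕ
window h s zero    v = 0
window h s (suc k) v = h v + window h s k (unit s ℤ.+ v)

-- Used for the neighbours of one sign `s`, whose moments are consecutive by `moment-move`.
sum-tabulate-window : ∀ h s k v (g : Fin k → ℕ) →
  (∀ i → g i ≡ h (unit s ℤ.* + index i ℤ.+ v)) → sum (tabulate g) ≡ window h s k v
sum-tabulate-window h s zero    v g g≡ = refl
sum-tabulate-window h s (suc k) v g g≡ = cong₂ _+_
  (trans (g≡ zero) (cong h (first (unit s) v)))
  (sum-tabulate-window h s k (unit s ℤ.+ v) (g ∘ suc) λ i →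
    trans (g≡ (suc i)) (cong h (later (unit s) (+ index i) v)))
  where
  first : ∀ p q → p ℤ.* 0ℤ ℤ.+ q ≡ q
  first = solve-∀
  later : ∀ p k q → p ℤ.* (1ℤ ℤ.+ k) ℤ.+ q ≡ p ℤ.* k ℤ.+ (p ℤ.+ q)
  later = solve-∀

sum-tabulate-+ : ∀ {k} (f g : Fin k → ℕ) →
  sum (tabulate λ i → f i + g i) ≡ sum (tabulate f) + sum (tabulate g)
sum-tabulate-+ {zero}  f g = refl
sum-tabulate-+ {suc k} f g rewrite sum-tabulate-+ (f ∘ suc) (g ∘ suc) =
  interchange (f zero) (g zero) (sum (tabulate (f ∘ suc))) (sum (tabulate (g ∘ suc)))
  where
  interchange : ∀ p q r s → (p + q) + (r + s) ≡ (p + r) + (q + s)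
  interchange = ℕSolver.solve-∀

module _ (h : ℤ → ℕ) where

  window-snoc : ∀ k v → window h ⊕ (suc k) v ≡ window h ⊕ k v + h (+ k ℤ.+ v)
  window-snoc zero    v = trans (ℕ.+-identityʳ (h v)) (cong h (sym (ℤ.+-identityˡ v)))
  window-snoc (suc k) v = begin
    h v + window h ⊕ (suc k) (1ℤ ℤ.+ v)                       ≡⟨ cong (λ m → h v + m) (window-snoc k (1ℤ ℤ.+ v)) ⟩
    h v + (window h ⊕ k (1ℤ ℤ.+ v) + h (+ k ℤ.+ (1ℤ ℤ.+ v)))  ≡⟨ ℕ.+-assoc (h v) _ _ ⟨
    window h ⊕ (suc k) v + h (+ k ℤ.+ (1ℤ ℤ.+ v))             ≡⟨ cong (λ w → window h ⊕ (suc k) v + h w) (next (+ k) v) ⟩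
    window h ⊕ (suc k) v + h (+ suc k ℤ.+ v)                  ∎
    where
    open ≡-Reasoning
    next : ∀ p q → p ℤ.+ (1ℤ ℤ.+ q) ≡ (1ℤ ℤ.+ p) ℤ.+ q
    next = solve-∀

  -- Both windows list the integers from 1 + v to k + v; the first term of the descending one is the
  -- term that `window-snoc` splits off the ascending one.
  window-reverse : ∀ k v → window h ⊖ k (+ k ℤ.+ v) ≡ window h ⊕ k (1ℤ ℤ.+ v)
  window-reverse zero    v = refl
  window-reverse (suc k) v = begin
    h (+ suc k ℤ.+ v) + window h ⊖ k (-1ℤ ℤ.+ (+ suc k ℤ.+ v))   ≡⟨ cong₂ (λ w w′ → h w + window h ⊖ k w′) (end (+ k) v) (shorter (+ k) v) ⟩
    h (+ k ℤ.+ (1ℤ ℤ.+ v)) + window h ⊖ k (+ k ℤ.+ v)            ≡⟨ cong (λ m → h (+ k ℤ.+ (1ℤ ℤ.+ v)) + m) (window-reverse k v) ⟩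
    h (+ k ℤ.+ (1ℤ ℤ.+ v)) + window h ⊕ k (1ℤ ℤ.+ v)             ≡⟨ ℕ.+-comm _ (window h ⊕ k (1ℤ ℤ.+ v)) ⟩
    window h ⊕ k (1ℤ ℤ.+ v) + h (+ k ℤ.+ (1ℤ ℤ.+ v))             ≡⟨ window-snoc k (1ℤ ℤ.+ v) ⟨
    window h ⊕ (suc k) (1ℤ ℤ.+ v)                                ∎
    where
    open ≡-Reasoning
    end : ∀ p q → (1ℤ ℤ.+ p) ℤ.+ q ≡ p ℤ.+ (1ℤ ℤ.+ q)
    end = solve-∀
    shorter : ∀ p q → -1ℤ ℤ.+ ((1ℤ ℤ.+ p) ℤ.+ q) ≡ p ℤ.+ q
    shorter = solve-∀

  module _ (n : ℕ) (periodic : ∀ v → h (+ n ℤ.+ v) ≡ h v) where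

    -- The window of length n + 1 at `v` can lose its first or its last term, and these two agree by
    -- periodicity.
    window-slide : ∀ v → window h ⊕ n (1ℤ ℤ.+ v) ≡ window h ⊕ n v
    window-slide v = ℕ.+-cancelˡ-≡ (h v) _ _ (begin
      window h ⊕ (suc n) v               ≡⟨ window-snoc n v ⟩
      window h ⊕ n v + h (+ n ℤ.+ v)     ≡⟨ cong (λ m → window h ⊕ n v + m) (periodic v) ⟩
      window h ⊕ n v + h v               ≡⟨ ℕ.+-comm _ (h v) ⟩
      h v + window h ⊕ n v               ∎)
      where open ≡-Reasoning

    window-const⁺ : ∀ v → window h ⊕ n v ≡ window h ⊕ n 0ℤ
    window-const⁺ (+ zero)      = refl
    window-const⁺ (+ suc m)     = trans (window-slide (+ m)) (window-const⁺ (+ m))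
    window-const⁺ -[1+ zero ]   = sym (window-slide -1ℤ)
    window-const⁺ -[1+ suc m ]  = trans (sym (window-slide -[1+ suc m ])) (window-const⁺ -[1+ m ])

    window-const : ∀ s v → window h s n v ≡ window h ⊕ n 0ℤ
    window-const ⊕ v = window-const⁺ v
    window-const ⊖ v = begin
      window h ⊖ n v                       ≡⟨ cong (window h ⊖ n) (split (+ n) v) ⟩
      window h ⊖ n (+ n ℤ.+ (v ℤ.- + n))   ≡⟨ window-reverse n (v ℤ.- + n) ⟩
      window h ⊕ n (1ℤ ℤ.+ (v ℤ.- + n))    ≡⟨ window-const⁺ (1ℤ ℤ.+ (v ℤ.- + n)) ⟩
      window h ⊕ n 0ℤ                      ∎
      where
      open ≡-Reasoning
      split : ∀ p q → q ≡ p ℤ.+ (q ℤ.- p)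
      split = solve-∀

-- Periodic sets with a given number of residues

module _ (n : ℕ) .{{_ : NonZero n}} where

  below : ℕ → ℤ → Bool
  below s w = does (w %ℕ n <? s)

  below-periodic : ∀ s w q → below s (w ℤ.+ q ℤ.* + n) ≡ below s w
  below-periodic s w q = cong (λ r → does (r <? s)) ([a+q*d]%d≡a%d n w q)

  below-true : ∀ {s m} → m < s → m < n → below s (+ m) ≡ true
  below-true {s} {m} m<s m<n rewrite m<n⇒m%n≡m m<n = dec-true (m <? s) m<s

  below-false : ∀ {s m} → s ≤ m → m < n → below s (+ m) ≡ false
  below-false {s} {m} s≤m m<n rewrite m<n⇒m%n≡m m<n = dec-false (m <? s) (ℕ.≤⇒≯ s≤m)

  window-above : ∀ s e m → s ≤ m → m + e ≤ n → window (toℕ ∘ below s) ⊕ e (+ m) ≡ 0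
  window-above s zero    m s≤m m+e≤n = refl
  window-above s (suc e) m s≤m m+e≤n
    rewrite ℕ.+-suc m e | below-false s≤m (ℕ.≤-trans (s≤s (ℕ.m≤m+n m e)) m+e≤n) =
    window-above s e (suc m) (ℕ.m≤n⇒m≤1+n s≤m) m+e≤n

  -- The induction raises the left end m and keeps the threshold m + d fixed. The bound by n keeps
  -- the whole window inside one period, where each number is its own residue.
  window-count : ∀ d e m → m + d + e ≤ n →
    window (toℕ ∘ below (m + d)) ⊕ (d + e) (+ m) ≡ d
  window-count zero    e m m+e≤n = window-above (m + 0) e m (ℕ.≤-reflexive (ℕ.+-identityʳ m))
    (subst (λ k → k + e ≤ n) (ℕ.+-identityʳ m) m+e≤n)
  window-count (suc d) e m m+d+e≤n
    rewrite ℕ.+-suc m d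
          | below-true {suc (m + d)} (s≤s (ℕ.m≤m+n m d))
              (ℕ.≤-trans (s≤s (ℕ.≤-trans (ℕ.m≤m+n m d) (ℕ.m≤m+n (m + d) e))) m+d+e≤n) =
    cong suc (window-count d e (suc m) m+d+e≤n)

  window-below : ∀ {s} → s ≤ n → ∀ t v → window (toℕ ∘ below s) t n v ≡ s
  window-below {s} s≤n t v = begin
    window (toℕ ∘ below s) t n v                ≡⟨ window-const (toℕ ∘ below s) n periodic t v ⟩
    window (toℕ ∘ below s) ⊕ n 0ℤ               ≡⟨ cong (λ k → window (toℕ ∘ below s) ⊕ k 0ℤ) (ℕ.m+[n∸m]≡n s≤n) ⟨
    window (toℕ ∘ below s) ⊕ (s + (n ℕ.∸ s)) 0ℤ ≡⟨ window-count s (n ℕ.∸ s) 0 (ℕ.≤-reflexive (ℕ.m+[n∸m]≡n s≤n)) ⟩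
    s                                           ∎
    where
    open ≡-Reasoning
    periodic : ∀ w → toℕ (below s (+ n ℤ.+ w)) ≡ toℕ (below s w)
    periodic w = cong toℕ (trans (cong (below s) (once (+ n) w)) (below-periodic s w 1ℤ))
      where
      once : ∀ p q → p ℤ.+ q ≡ q ℤ.+ 1ℤ ℤ.* p
      once = solve-∀

-- The colorings

-- On height u the coloring is n-periodic in the moment with width (u mod 4) residues colored,
-- and it is translated by the bit δ q on the block 4nq ≤ u < 4n(q+1).
module Coloring (n : ℕ) .{{_ : NonZero n}} (a b : ℕ) where

  instance
    4n≢0 : NonZero (n * 4)
    4n≢0 = ℕ.m*n≢0 n 4

  width : ℕ → ℕ
  width 0 = a
  width 1 = a
  width _ = b

  -- The heights u - 1 and u + 1 are half a period of a, a, b, b apart, so one has width a and the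
  -- other width b. Dividing u - 1 by 4 expresses both residues through `r`, which leaves four
  -- cases.
  width-antiperiodic : ∀ u → width ((1ℤ ℤ.+ u) %ℕ 4) + width ((-1ℤ ℤ.+ u) %ℕ 4) ≡ a + b
  width-antiperiodic u = begin
    width ((1ℤ ℤ.+ u) %ℕ 4) + width r   ≡⟨ cong (λ w → width (w %ℕ 4) + width r) 1+u≡ ⟩
    width ((+ (2 + r) ℤ.+ q ℤ.* + 4) %ℕ 4) + width r
                                        ≡⟨ cong (λ m → width m + width r) ([a+q*d]%d≡a%d 4 (+ (2 + r)) q) ⟩
    width ((2 + r) ℕ.% 4) + width r     ≡⟨ check r (n%ℕd<d u⁻ 4) ⟩
    a + b                               ∎
    where
    open ≡-Reasoning
    u⁻ = -1ℤ ℤ.+ u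
    q = u⁻ /ℕ 4
    r = u⁻ %ℕ 4

    1+u≡ : 1ℤ ℤ.+ u ≡ + (2 + r) ℤ.+ q ℤ.* + 4
    1+u≡ = begin
      1ℤ ℤ.+ u                               ≡⟨ shift u ⟩
      + 2 ℤ.+ u⁻                             ≡⟨ cong (λ w → + 2 ℤ.+ w) (a≡a%ℕn+[a/ℕn]*n u⁻ 4) ⟩
      + 2 ℤ.+ (+ r ℤ.+ q ℤ.* + 4)            ≡⟨ ℤ.+-assoc (+ 2) (+ r) (q ℤ.* + 4) ⟨
      + (2 + r) ℤ.+ q ℤ.* + 4                ∎
      where
      shift : ∀ p → 1ℤ ℤ.+ p ≡ + 2 ℤ.+ (-1ℤ ℤ.+ p)
      shift = solve-∀

    check : ∀ r → r < 4 → width ((2 + r) ℕ.% 4) + width r ≡ a + b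
    check 0 _ = ℕ.+-comm b a
    check 1 _ = ℕ.+-comm b a
    check 2 _ = refl
    check 3 _ = refl
    check (suc (suc (suc (suc _)))) (s≤s (s≤s (s≤s (s≤s ()))))

  width-≤ : a ≤ n → b ≤ n → ∀ r → width r ≤ n
  width-≤ a≤n b≤n 0             = a≤n
  width-≤ a≤n b≤n 1             = a≤n
  width-≤ a≤n b≤n (suc (suc _)) = b≤n

  -- With the bit as last argument, a fixed height and moment give a map `Bool → Bool`, the form in
  -- which `signal-determined` compares two signals.
  hue : (u v : ℤ) → Bool → Bool
  hue u v d = below n (width (u %ℕ 4)) (v ℤ.- + toℕ d)

  color : (ℤ → Bool) → Point n → Bool
  color δ x = hue (height x) (moment x) (δ (height x /ℕ (n * 4)))

  -- All neighbours of one sign share their height, hence their width and shift bit. Their moments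
  -- fill a window of length n, so they contribute exactly that width.
  color-biased : a ≤ n → b ≤ n → ∀ δ → Biased n (a + b) (color δ)
  color-biased a≤n b≤n δ x = begin
    nbrCount (color δ) x
      ≡⟨ cong sum (map-tabulate (λ i → i) (λ i → value ⊕ i + value ⊖ i)) ⟩
    sum (tabulate λ i → value ⊕ i + value ⊖ i)
      ≡⟨ sum-tabulate-+ (value ⊕) (value ⊖) ⟩
    sum (tabulate (value ⊕)) + sum (tabulate (value ⊖))
      ≡⟨ cong₂ _+_ (half ⊕) (half ⊖) ⟩
    width ((1ℤ ℤ.+ height x) %ℕ 4) + width ((-1ℤ ℤ.+ height x) %ℕ 4)
      ≡⟨ width-antiperiodic (height x) ⟩
    a + b ∎
    where
    open ≡-Reasoning

    value : Sign → Fin n → ℕ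
    value s i = toℕ (color δ (move s i x))

    half : ∀ s → sum (tabulate (value s)) ≡ width ((unit s ℤ.+ height x) %ℕ 4)
    half s = begin
      sum (tabulate (value s))
        ≡⟨ sum-tabulate-window (toℕ ∘ below n w) s n (moment x ℤ.- d) (value s) value≡ ⟩
      window (toℕ ∘ below n w) s n (moment x ℤ.- d)
        ≡⟨ window-below n (width-≤ a≤n b≤n ((unit s ℤ.+ height x) %ℕ 4)) s (moment x ℤ.- d) ⟩
      w ∎
      where
      w = width ((unit s ℤ.+ height x) %ℕ 4)
      d = + toℕ (δ ((unit s ℤ.+ height x) /ℕ (n * 4)))

      value≡ : ∀ i → value s i ≡ toℕ (below n w (unit s ℤ.* + index i ℤ.+ (moment x ℤ.- d)))
      value≡ i rewrite height-move s i x | moment-move s i x =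
        cong (toℕ ∘ below n w) (ℤ.+-assoc (unit s ℤ.* + index i) (moment x) (ℤ.- d))

  -- In any coordinate direction, 4nj steps change the height by a multiple of 4n and the moment by
  -- a multiple of n. Width and residue are kept, and only the block index moves, by j up or down.
  color-walk : ∀ δ s i j (x : Point n) →
    color δ (walk s i (j * (n * 4)) x) ≡
      hue (height x) (moment x) (δ (height x /ℕ (n * 4) ℤ.+ unit s ℤ.* + j))
  color-walk δ s i j x = begin
    hue (height y) (moment y) (δ (height y /ℕ (n * 4)))
      ≡⟨ cong₂ (λ u v → hue u v (δ (u /ℕ (n * 4)))) height-y moment-y ⟩
    hue (u ℤ.+ z ℤ.* + (n * 4)) (v ℤ.+ l ℤ.* + n) (δ ((u ℤ.+ z ℤ.* + (n * 4)) /ℕ (n * 4)))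
      ≡⟨ cong (λ q → hue (u ℤ.+ z ℤ.* + (n * 4)) (v ℤ.+ l ℤ.* + n) (δ q)) ([a+q*d]/d≡a/d+q (n * 4) u z) ⟩
    hue (u ℤ.+ z ℤ.* + (n * 4)) (v ℤ.+ l ℤ.* + n) (δ (u /ℕ (n * 4) ℤ.+ z))
      ≡⟨ hue-periodic (δ (u /ℕ (n * 4) ℤ.+ z)) ⟩
    hue u v (δ (u /ℕ (n * 4) ℤ.+ z)) ∎
    where
    open ≡-Reasoning
    y = walk s i (j * (n * 4)) x
    u = height x
    v = moment x
    z = unit s ℤ.* + j
    l = z ℤ.* + 4 ℤ.* + index i

    step≡ : unit s ℤ.* + (j * (n * 4)) ≡ z ℤ.* + (n * 4)
    step≡ = trans (cong (λ m → unit s ℤ.* m) (ℤ.pos-* j (n * 4)))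
                  (sym (ℤ.*-assoc (unit s) (+ j) (+ (n * 4))))

    height-y : height y ≡ u ℤ.+ z ℤ.* + (n * 4)
    height-y = trans (height-walk s i x (j * (n * 4))) (cong (λ m → u ℤ.+ m) step≡)

    moment-y : moment y ≡ v ℤ.+ l ℤ.* + n
    moment-y = begin
      moment y                                                ≡⟨ moment-walk s i x (j * (n * 4)) ⟩
      v ℤ.+ (unit s ℤ.* + (j * (n * 4))) ℤ.* + index i        ≡⟨ cong (λ m → v ℤ.+ m ℤ.* + index i) (trans step≡ (cong (λ m → z ℤ.* m) (ℤ.pos-* n 4))) ⟩
      v ℤ.+ (z ℤ.* (+ n ℤ.* + 4)) ℤ.* + index i               ≡⟨ cong (λ m → v ℤ.+ m) (regroup z (+ n) (+ index i)) ⟩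
      v ℤ.+ l ℤ.* + n                                         ∎
      where
      regroup : ∀ p q k → (p ℤ.* (q ℤ.* + 4)) ℤ.* k ≡ (p ℤ.* + 4 ℤ.* k) ℤ.* q
      regroup = solve-∀

    hue-periodic : ∀ d → hue (u ℤ.+ z ℤ.* + (n * 4)) (v ℤ.+ l ℤ.* + n) d ≡ hue u v d
    hue-periodic d = begin
      below n (width ((u ℤ.+ z ℤ.* + (n * 4)) %ℕ 4)) ((v ℤ.+ l ℤ.* + n) ℤ.- + toℕ d)
        ≡⟨ cong₂ (λ r w → below n (width r) w) period-4 (swap v (l ℤ.* + n) (+ toℕ d)) ⟩
      below n (width (u %ℕ 4)) ((v ℤ.- + toℕ d) ℤ.+ l ℤ.* + n)
        ≡⟨ below-periodic n (width (u %ℕ 4)) (v ℤ.- + toℕ d) l ⟩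
      hue u v d ∎
      where
      swap : ∀ p q r → (p ℤ.+ q) ℤ.- r ≡ (p ℤ.- r) ℤ.+ q
      swap = solve-∀
      period-4 : (u ℤ.+ z ℤ.* + (n * 4)) %ℕ 4 ≡ u %ℕ 4
      period-4 = trans
        (cong (λ m → (u ℤ.+ m) %ℕ 4) (trans (cong (λ m → z ℤ.* m) (ℤ.pos-* n 4)) (sym (ℤ.*-assoc z (+ n) (+ 4)))))
        ([a+q*d]%d≡a%d 4 u (z ℤ.* + n))

-- Encoding a binary sequence in the shift bits

stream : (ℕ → Bool) → ℕ → Bool
stream s 0                   = true
stream s 1                   = false
stream s 2                   = s 0
stream s (suc (suc (suc m))) = stream (s ∘ suc) m

-- The marks true, false in each block of three keep the signal from being eventually constant,
-- in contrast to its values on the negatives.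
signal : (ℕ → Bool) → ℤ → Bool
signal s (+ m)    = stream s m
signal s -[1+ _ ] = false

stream-0 : ∀ s k → stream s (k * 3) ≡ true
stream-0 s zero    = refl
stream-0 s (suc k) = stream-0 (s ∘ suc) k

stream-1 : ∀ s k → stream s (1 + k * 3) ≡ false
stream-1 s zero    = refl
stream-1 s (suc k) = stream-1 (s ∘ suc) k

stream-2 : ∀ s k → stream s (2 + k * 3) ≡ s k
stream-2 s zero    = refl
stream-2 s (suc k) = stream-2 (s ∘ suc) k

signal-< : ∀ s {z} → z ℤ.< 0ℤ → signal s z ≡ false
signal-< s ℤ.-<+            = refl
signal-< s (ℤ.+<+ ())

∣i∣<m⇒i-m<0 : ∀ i {m} → ∣ i ∣ < m → i ℤ.- + m ℤ.< 0ℤ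
∣i∣<m⇒i-m<0 i {m} ∣i∣<m =
  subst (i ℤ.- + m ℤ.<_) (ℤ.+-inverseʳ (+ m)) (ℤ.+-monoˡ-< (ℤ.- + m) (i<m i ∣i∣<m))
  where
  i<m : ∀ i → ∣ i ∣ < m → i ℤ.< + m
  i<m (+ _)    p = ℤ.+<+ p
  i<m -[1+ _ ] p = ℤ.-<+

-- Both signals have their first `true` at 0, which forces q = 0: a positive q fails at z = -q and a
-- negative one at z = 0. The bits then sit at the positions 2 + 3k.
signal-shift : ∀ s t q → (∀ z → signal s z ≡ signal t (q ℤ.+ z)) → ∀ k → s k ≡ t k
signal-shift s t (+ zero)  eq k = begin
  s k                                ≡⟨ stream-2 s k ⟨
  stream s (2 + k * 3)               ≡⟨ eq (+ (2 + k * 3)) ⟩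
  stream t (2 + k * 3)               ≡⟨ stream-2 t k ⟩
  t k                                ∎
  where open ≡-Reasoning
signal-shift s t (+ suc m) eq k =
  contradiction (trans (eq -[1+ m ]) (cong (signal t) (ℤ.+-inverseʳ (+ suc m)))) λ ()
signal-shift s t -[1+ m ]  eq k = contradiction (eq 0ℤ) λ ()

-- The two ends of a signal differ, which excludes the reflections.
signal-determined : ∀ s t (A B : Bool → Bool) q r → A true ≢ A false →
  (∀ z → A (signal s z) ≡ B (signal t (q ℤ.+ unit r ℤ.* z))) → ∀ k → s k ≡ t k
signal-determined s t A B q ⊖ At≢Af eq k = contradiction (begin
  A true                                ≡⟨ eq 0ℤ ⟩
  B (signal t (q ℤ.+ -1ℤ ℤ.* 0ℤ))       ≡⟨ constant (signal t (q ℤ.+ -1ℤ ℤ.* 0ℤ)) ⟩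
  A false                               ∎) At≢Af
  where
  open ≡-Reasoning
  K = suc ∣ q ∣

  reflected : ∀ m → K ≤ m → B (stream t m) ≡ A false
  reflected m K≤m = begin
    B (signal t (+ m))                             ≡⟨ cong (B ∘ signal t) (flip q (+ m)) ⟩
    B (signal t (q ℤ.+ -1ℤ ℤ.* (q ℤ.- + m)))       ≡⟨ eq (q ℤ.- + m) ⟨
    A (signal s (q ℤ.- + m))                       ≡⟨ cong A (signal-< s (∣i∣<m⇒i-m<0 q K≤m)) ⟩
    A false                                        ∎
    where
    flip : ∀ p m → m ≡ p ℤ.+ -1ℤ ℤ.* (p ℤ.- m)
    flip = solve-∀

  -- The marks at 3K and 3K + 1 lie beyond the bound, so both bits occur there and `B` is constant.
  constant : ∀ d → B d ≡ A false
  constant true  = trans (cong B (sym (stream-0 t K))) (reflected (K * 3) (ℕ.m≤m*n K 3))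
  constant false = trans (cong B (sym (stream-1 t K)))
                         (reflected (1 + K * 3) (ℕ.m≤n⇒m≤1+n (ℕ.m≤m*n K 3)))
-- A position far to the left gives `B false ≡ A false`, and then position 0 gives
-- `B true ≡ A true`. As `A` is injective, both maps cancel and a pure shift remains.
signal-determined s t A B q ⊕ At≢Af eq =
  signal-shift s t q λ z → A-injective (trans (shifted z) (B≗A (signal t (q ℤ.+ z))))
  where
  open ≡-Reasoning

  shifted : ∀ z → A (signal s z) ≡ B (signal t (q ℤ.+ z))
  shifted z = trans (eq z) (cong (λ w → B (signal t (q ℤ.+ w))) (ℤ.*-identityˡ z))

  Bf≡Af : B false ≡ A false
  Bf≡Af = begin
    B false                                  ≡⟨ cong B (signal-< t (∣i∣<m⇒i-m<0 q ℕ.≤-refl)) ⟨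
    B (signal t (q ℤ.- + suc ∣ q ∣))         ≡⟨ shifted -[1+ ∣ q ∣ ] ⟨
    A false                                  ∎

  Bt≡At : B true ≡ A true
  Bt≡At with signal t (q ℤ.+ 0ℤ) | shifted 0ℤ
  ... | true  | At≡Bt = sym At≡Bt
  ... | false | At≡Bf = contradiction (trans At≡Bf Bf≡Af) At≢Af

  B≗A : ∀ d → B d ≡ A d
  B≗A true  = Bt≡At
  B≗A false = Bf≡Af

  A-injective : ∀ {d e} → A d ≡ A e → d ≡ e
  A-injective {true}  {true}  _ = refl
  A-injective {true}  {false} p = contradiction p At≢Af
  A-injective {false} {true}  p = contradiction (sym p) At≢Af
  A-injective {false} {false} _ = refl

-- Isomorphic colorings come from equal sequences

height-origin : ∀ n → height (replicate n 0ℤ) ≡ 0ℤ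
height-origin zero    = refl
height-origin (suc n) = trans (ℤ.+-identityˡ _) (height-origin n)

moment-origin : ∀ n → moment (replicate n 0ℤ) ≡ 0ℤ
moment-origin zero    = refl
moment-origin (suc n) rewrite height-origin n | moment-origin n = refl

module _ (m a b : ℕ) (0<a : 0 < a) (a≤1+m : a ≤ suc m) where

  private
    n : ℕ
    n = suc (suc m)

  open Coloring n a b

  origin : Point n
  origin = replicate n 0ℤ

  home : Bool → Bool
  home = hue (height origin) (moment origin)

  -- The origin has width a and residue 0, which is colored as 0 < a. Shifting by 1 turns the
  -- residue into -1, that is n - 1, which is not colored as a < n.
  home-separates : home true ≢ home false
  home-separates rewrite height-origin n | moment-origin n
    | dec-false (suc m <? a) (ℕ.≤⇒≯ a≤1+m) | dec-true (0 <? a) 0<a = λ ()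

  -- The first coloring is read along an axis through the origin, the second along the image line
  -- through `φ origin`, both in steps of 4n. By `color-walk` this shows the two signals through
  -- `home` and `away`, with `r` the orientation of the image line.
  color-separates : ∀ s t → Iso (color (signal s)) (color (signal t)) → ∀ k → s k ≡ t k
  color-separates s t (A , f≡g∘φ) with line-image A zero origin
  ... | r , i , image = signal-determined s t
    home away q r home-separates along
    where
    open ≡-Reasoning
    open Automorphism A
    y = φ origin
    q = height y /ℕ (n * 4)

    away : Bool → Bool
    away = hue (height y) (moment y)

    origin-q : height origin /ℕ (n * 4) ≡ 0ℤ
    origin-q rewrite height-origin n = refl

    along-ray : ∀ p j →
      home (signal s (unit p ℤ.* + j)) ≡
      away (signal t (q ℤ.+ unit (r · p) ℤ.* + j))
    along-ray p j = begin
      home (signal s (unit p ℤ.* + j))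
        ≡⟨ cong (home ∘ signal s) (trans (cong (ℤ._+ unit p ℤ.* + j) origin-q) (ℤ.+-identityˡ (unit p ℤ.* + j))) ⟨
      home (signal s (height origin /ℕ (n * 4) ℤ.+ unit p ℤ.* + j))
        ≡⟨ color-walk (signal s) p zero j origin ⟨
      color (signal s) (walk p zero (j * (n * 4)) origin)
        ≡⟨ f≡g∘φ _ ⟩
      color (signal t) (φ (walk p zero (j * (n * 4)) origin))
        ≡⟨ cong (color (signal t)) (image p (j * (n * 4))) ⟩
      color (signal t) (walk (r · p) i (j * (n * 4)) y)
        ≡⟨ color-walk (signal t) (r · p) i j y ⟩
      away (signal t (q ℤ.+ unit (r · p) ℤ.* + j)) ∎

    unit-· : ∀ r p → unit (r · p) ≡ unit r ℤ.* unit p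
    unit-· ⊕ ⊕ = refl
    unit-· ⊕ ⊖ = refl
    unit-· ⊖ ⊕ = refl
    unit-· ⊖ ⊖ = refl

    along : ∀ z → home (signal s z) ≡
                  away (signal t (q ℤ.+ unit r ℤ.* z))
    along z with polar z
      where
      polar : ∀ z → Σ Sign λ p → Σ ℕ λ j → z ≡ unit p ℤ.* + j
      polar (+ j)    = ⊕ , j , sym (ℤ.*-identityˡ (+ j))
      polar -[1+ j ] = ⊖ , suc j , sym (ℤ.-1*i≡-i (+ suc j))
    ... | p , j , refl = trans (along-ray p j) (cong (λ w → away (signal t (q ℤ.+ w)))
      (trans (cong (ℤ._* + j) (unit-· r p)) (ℤ.*-assoc (unit r) (unit p) (+ j))))

-- Coding arbitrary functions by binary sequences

-- ℕᵇ serves as the type of bit strings, and integers are written with a self-delimiting code: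
-- a sign bit, then the absolute value in unary.
encodeℕ : ℕ → ℕᵇ → ℕᵇ
encodeℕ zero    rest = 2[1+ rest ]
encodeℕ (suc m) rest = 1+[2 encodeℕ m rest ]

decodeℕ : ℕᵇ → ℕ × ℕᵇ
-- A default value for strings that end before the terminator `2[1+_]`.
decodeℕ ℕᵇ.zero    = 0 , ℕᵇ.zero
decodeℕ 2[1+ c ]   = 0 , c
decodeℕ 1+[2 c ]   = suc (proj₁ (decodeℕ c)) , proj₂ (decodeℕ c)

decodeℕ-encodeℕ : ∀ m rest → decodeℕ (encodeℕ m rest) ≡ (m , rest)
decodeℕ-encodeℕ zero    rest = refl
decodeℕ-encodeℕ (suc m) rest rewrite decodeℕ-encodeℕ m rest = refl

encodePoint : ∀ {n} → Point n → ℕᵇ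
encodePoint []             = ℕᵇ.zero
encodePoint (+ m ∷ x)      = 2[1+ encodeℕ m (encodePoint x) ]
encodePoint (-[1+ m ] ∷ x) = 1+[2 encodeℕ m (encodePoint x) ]

decodePoint : ∀ n → ℕᵇ → Point n
decodePoint zero    c          = []
decodePoint (suc n) ℕᵇ.zero    = 0ℤ ∷ decodePoint n ℕᵇ.zero
decodePoint (suc n) 2[1+ c ]   = + proj₁ (decodeℕ c) ∷ decodePoint n (proj₂ (decodeℕ c))
decodePoint (suc n) 1+[2 c ]   = -[1+ proj₁ (decodeℕ c) ] ∷ decodePoint n (proj₂ (decodeℕ c))

decodePoint-encodePoint : ∀ {n} (x : Point n) → decodePoint n (encodePoint x) ≡ x
decodePoint-encodePoint []             = refl
decodePoint-encodePoint (+ m ∷ x)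
  rewrite decodeℕ-encodeℕ m (encodePoint x) = cong (+ m ∷_) (decodePoint-encodePoint x)
decodePoint-encodePoint (-[1+ m ] ∷ x)
  rewrite decodeℕ-encodeℕ m (encodePoint x) = cong (-[1+ m ] ∷_) (decodePoint-encodePoint x)

identity : ∀ {n} → Automorphism n
identity = record
  { φ = λ x → x ; φ⁻¹ = λ x → x ; invˡ = λ _ → refl ; invʳ = λ _ → refl
  ; pres = λ _ _ p → p ; refl' = λ _ _ p → p }

paint : ∀ {n} → (ℕ → Bool) → Point n → Bool
paint s x = s (toNat (encodePoint x))

-- The sequence lists the values of `f` at the decoded points. Decoding undoes encoding, so painting
-- with it returns `f` itself.
paint-surjective : ∀ {n} (f : Point n → Bool) → Σ (ℕ → Bool) λ s → Iso (paint s) f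
paint-surjective {n} f = (λ k → f (decodePoint n (fromNat k))) , identity , λ x →
  cong f (trans (cong (decodePoint n) (ℕᵇ.fromℕ-toℕ (encodePoint x))) (decodePoint-encodePoint x))

-- Only for 0 < a < n does a shift change the colors on a height of width a.
split-widths : ∀ m c → 1 ≤ c → c < 2 * suc (suc m) →
  Σ ℕ λ a → Σ ℕ λ b → a + b ≡ c × 0 < a × a ≤ suc m × b ≤ suc (suc m)
split-widths m c 1≤c c<2n with ℕ.<-cmp c (suc (suc m))
... | tri< (s≤s c≤1+m) _ _ = c , 0 , ℕ.+-identityʳ c , 1≤c , c≤1+m , z≤n
-- Widths n and 0 would be blind to shifts, so one residue is traded: 1 and n - 1, where 1 < n.
... | tri≈ _ refl _        = 1 , suc m , refl , ℕ.≤-refl , s≤s z≤n , ℕ.n≤1+n (suc m)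
... | tri> _ _ n<c         =
  c ℕ.∸ n , n , ℕ.m∸n+n≡m (ℕ.<⇒≤ n<c) , ℕ.m<n⇒0<n∸m n<c , excess , ℕ.≤-refl
  where
  n = suc (suc m)
  excess : c ℕ.∸ n ≤ suc m
  excess = ℕ.s≤s⁻¹ (subst (c ℕ.∸ n <_) (trans (ℕ.m+n∸m≡n n (n + 0)) (ℕ.+-identityʳ n))
                          (ℕ.∸-monoˡ-< c<2n (ℕ.<⇒≤ n<c)))

theorem4p1 : (n c : ℕ) → 1 < n → 1 ≤ c → c < 2 * n →
    (Σ ((ℕ → Bool) → (Point n → Bool)) λ F →
    (∀ s → Biased n c (F s))
    × (∀ s t → Iso (F s) (F t) → ∀ k → s k ≡ t k))
    × (Σ ((ℕ → Bool) → (Point n → Bool)) λ G →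
    ∀ f → Biased n c f → Σ (ℕ → Bool) λ s → Iso (G s) f)
theorem4p1 (suc (suc m)) c (s≤s (s≤s z≤n)) 1≤c c<2n with split-widths m c 1≤c c<2n
... | a , b , refl , 0<a , a≤1+m , b≤n =
  (color ∘ signal , (λ s → color-biased (ℕ.m≤n⇒m≤1+n a≤1+m) b≤n (signal s)) ,
    color-separates m a b 0<a a≤1+m) ,
  paint , λ f _ → paint-surjective f
  where open Coloring (suc (suc m)) a b
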